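{- Let $p$ be a prime and let $Q \in \mathbb{Z}[x]$ be a nonzero polynomial. Then the sequence $V_p(Q) = \{\nu_p(Q(n)) : n \in \mathbb{N}\}$ is either periodic or unbounded. Moreover, $V_p(Q)$ is periodic if and only if $Q$ has no zeros in the ring $\mathbb{Z}_p$ of $p$-adic integers. In the periodic case, the minimal period length is a power of $p$.
   Context: $\mathbb{N} = \{0,1,2,\dots\}$. For a prime $p$ and a nonzero integer $m$, $\nu_p(m)$ is the exponent of the highest power of $p$ dividing $m$, and $\nu_p(0) = \infty$. A sequence $(s_n)_{n \in \mathbb{N}}$ is periodic if there is an integer $T \geq 1$ with $s_{n+T} = s_n$ for all $n \in \mathbb{N}$; the least such $T$ is the minimal period length. Powers of $p$ include $p^0 = 1$. A sequence with values in $\mathbb{N} \cup \{\infty\}$ is unbounded if it is not bounded above by any element of $\mathbb{N}$. -}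

module Defs where

open import Algebra.Bundles using (CommutativeRing)
open import Algebra.Structures using (IsCommutativeRing)
open import Data.Integer.Base as ℤ using (ℤ; +_; -[1+_]; +[1+_]; 0ℤ; 1ℤ; ∣_∣)
open import Data.Integer.Divisibility.Signed
  using (_∣_; divides; ∣m∣n⇒∣m+n; ∣m⇒∣-m; ∣n⇒∣m*n; ∣m⇒∣m*n)
import Data.Integer.Properties as ℤ
open import Data.Integer.Tactic.RingSolver using (solve-∀)
open import Data.List.Base using (List; []; _∷_)
open import Data.List.Relation.Unary.Any using (Any)
open import Data.Nat.Base as ℕ using (ℕ; zero; suc; _^_; _≤_; NonTrivial)
import Data.Nat.Divisibility as ℕ
import Data.Nat.Properties as ℕ
open import Data.Product.Base using (_×_; _,_; ∃-syntax)
open import Data.Sum.Base using (inj₁; inj₂)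
open import Level using (Level; 0ℓ)
open import Relation.Binary.Construct.Add.Supremum.NonStrict ℕ._≤_ using (_≤⁺_)
open import Relation.Binary.PropositionalEquality
  using (_≡_; _≢_; refl; sym; subst)
open import Relation.Nullary using (¬_; yes; no; contradiction)
open import Relation.Nullary.Construct.Add.Supremum using (_⁺; [_]; ⊤⁺)

private
  variable
    a c ℓ : Level

-- Coefficients, constant term first.  Trailing zeros are allowed, so the zero
-- polynomial is any list of zeros.
ℤ[x] : Set
ℤ[x] = List ℤ

NonZeroPoly : ℤ[x] → Set
NonZeroPoly = Any (_≢ 0ℤ)

-- The coefficients are carried into R along ι (a ring homomorphism in both
-- uses below).
evalIn : (R : CommutativeRing c ℓ) → (ℤ → CommutativeRing.Carrier R) →
         ℤ[x] → CommutativeRing.Carrier R → CommutativeRing.Carrier R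
evalIn R ι []      x = CommutativeRing.0# R
evalIn R ι (a ∷ q) x = ι a + x * evalIn R ι q x
  where open CommutativeRing R

eval : ℤ[x] → ℤ → ℤ
eval = evalIn ℤ.+-*-commutativeRing (λ a → a)

exponentUpTo : ℕ → ℕ → ℕ → ℕ
exponentUpTo p m zero    = zero
exponentUpTo p m (suc b) with p ^ suc b ℕ.∣? m
... | yes _ = suc b
... | no  _ = exponentUpTo p m b

-- Searching up to ∣ m ∣ suffices, since k < p ^ k for p ≥ 2; see ν-greatest.
ν : ℕ → ℤ → ℕ ⁺
ν p (+ zero)   = ⊤⁺
ν p m@(+[1+ _ ]) = [ exponentUpTo p ∣ m ∣ ∣ m ∣ ]
ν p m@(-[1+ _ ]) = [ exponentUpTo p ∣ m ∣ ∣ m ∣ ]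

exponentUpTo-∣ : ∀ p m b → p ^ exponentUpTo p m b ℕ.∣ m
exponentUpTo-∣ p m zero    = ℕ.1∣ m
exponentUpTo-∣ p m (suc b) with p ^ suc b ℕ.∣? m
... | yes d = d
... | no  _ = exponentUpTo-∣ p m b

exponentUpTo-greatest : ∀ p m b j → j ≤ b → p ^ j ℕ.∣ m → j ≤ exponentUpTo p m b
exponentUpTo-greatest p m zero    j j≤b d = j≤b
exponentUpTo-greatest p m (suc b) j j≤b d with p ^ suc b ℕ.∣? m
... | yes _  = j≤b
... | no  ∤m with ℕ.m≤n⇒m<n∨m≡n j≤b
...   | inj₁ j<1+b = exponentUpTo-greatest p m b j (ℕ.s≤s⁻¹ j<1+b) d
...   | inj₂ refl  = contradiction d ∤m

n<p^n : ∀ p .{{_ : NonTrivial p}} n → n ℕ.< p ^ n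
n<p^n p zero    = ℕ.s≤s ℕ.z≤n
n<p^n p (suc n) = begin-strict
  suc n        ≤⟨ n<p^n p n ⟩
  p ^ n        <⟨ ℕ.m<m*n (p ^ n) p {{ℕ.>-nonZero (ℕ.≤-<-trans ℕ.z≤n (n<p^n p n))}}
                    (ℕ.nonTrivial⇒n>1 p) ⟩
  p ^ n ℕ.* p  ≡⟨ ℕ.*-comm (p ^ n) p ⟩
  p ℕ.* p ^ n  ∎
  where open ℕ.≤-Reasoning

private
  exponent-bound : ∀ p .{{_ : NonTrivial p}} m .{{_ : ℕ.NonZero m}} j →
                   p ^ j ℕ.∣ m → j ≤ m
  exponent-bound p m j d = ℕ.<⇒≤ (ℕ.<-≤-trans (n<p^n p j) (ℕ.∣⇒≤ d))

ν-∣ : ∀ p m k → ν p m ≡ [ k ] → p ^ k ℕ.∣ ∣ m ∣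
ν-∣ p m@(+[1+ _ ]) _ refl = exponentUpTo-∣ p ∣ m ∣ ∣ m ∣
ν-∣ p m@(-[1+ _ ]) _ refl = exponentUpTo-∣ p ∣ m ∣ ∣ m ∣

ν-greatest : ∀ p .{{_ : NonTrivial p}} m k → ν p m ≡ [ k ] →
             ∀ j → p ^ j ℕ.∣ ∣ m ∣ → j ≤ k
ν-greatest p m@(+[1+ _ ]) _ refl j d =
  exponentUpTo-greatest p ∣ m ∣ ∣ m ∣ j (exponent-bound p ∣ m ∣ j d) d
ν-greatest p m@(-[1+ _ ]) _ refl j d =
  exponentUpTo-greatest p ∣ m ∣ ∣ m ∣ j (exponent-bound p ∣ m ∣ j d) d

V : ℕ → ℤ[x] → ℕ → ℕ ⁺
V p Q n = ν p (eval Q (+ n))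

IsPeriod : {A : Set a} → (ℕ → A) → ℕ → Set a
IsPeriod s T = 1 ≤ T × (∀ n → s (n ℕ.+ T) ≡ s n)

Periodic : {A : Set a} → (ℕ → A) → Set a
Periodic s = ∃[ T ] IsPeriod s T

IsMinimalPeriod : {A : Set a} → (ℕ → A) → ℕ → Set a
IsMinimalPeriod s T = IsPeriod s T × (∀ T′ → IsPeriod s T′ → T ≤ T′)

Unbounded : (ℕ → ℕ ⁺) → Set
Unbounded s = ∀ B → ¬ (∀ n → s n ≤⁺ [ B ])

IsPowerOf : ℕ → ℕ → Set
IsPowerOf p n = ∃[ k ] n ≡ p ^ k

infix 4 _≡_[mod_]

record _≡_[mod_] (a b : ℤ) (m : ℕ) : Set where
  constructor congruent
  field
    divisible : + m ∣ a ℤ.- b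

module _ {m : ℕ} where

  mod-reflexive : ∀ {a b} → a ≡ b → a ≡ b [mod m ]
  mod-reflexive {a} refl =
    congruent (subst (+ m ∣_) (sym (ℤ.+-inverseʳ a)) (divides 0ℤ refl))

  mod-sym : ∀ {a b} → a ≡ b [mod m ] → b ≡ a [mod m ]
  mod-sym {a} {b} (congruent d) = congruent (subst (+ m ∣_) (eq a b) (∣m⇒∣-m d))
    where
    eq : ∀ a b → ℤ.- (a ℤ.- b) ≡ b ℤ.- a
    eq = solve-∀

  mod-trans : ∀ {a b c} → a ≡ b [mod m ] → b ≡ c [mod m ] → a ≡ c [mod m ]
  mod-trans {a} {b} {c} (congruent d) (congruent e) =
    congruent (subst (+ m ∣_) (eq a b c) (∣m∣n⇒∣m+n d e))
    where
    eq : ∀ a b c → (a ℤ.- b) ℤ.+ (b ℤ.- c) ≡ a ℤ.- c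
    eq = solve-∀

  mod-+ : ∀ {a b c d} → a ≡ b [mod m ] → c ≡ d [mod m ] →
          a ℤ.+ c ≡ b ℤ.+ d [mod m ]
  mod-+ {a} {b} {c} {d} (congruent p) (congruent q) =
    congruent (subst (+ m ∣_) (eq a b c d) (∣m∣n⇒∣m+n p q))
    where
    eq : ∀ a b c d → (a ℤ.- b) ℤ.+ (c ℤ.- d) ≡ (a ℤ.+ c) ℤ.- (b ℤ.+ d)
    eq = solve-∀

  mod-* : ∀ {a b c d} → a ≡ b [mod m ] → c ≡ d [mod m ] →
          a ℤ.* c ≡ b ℤ.* d [mod m ]
  mod-* {a} {b} {c} {d} (congruent p) (congruent q) =
    congruent (subst (+ m ∣_) (eq a b c d) (∣m∣n⇒∣m+n (∣m⇒∣m*n c p) (∣n⇒∣m*n b q)))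
    where
    eq : ∀ a b c d → (a ℤ.- b) ℤ.* c ℤ.+ b ℤ.* (c ℤ.- d) ≡ a ℤ.* c ℤ.- b ℤ.* d
    eq = solve-∀

  mod-neg : ∀ {a b} → a ≡ b [mod m ] → ℤ.- a ≡ ℤ.- b [mod m ]
  mod-neg {a} {b} (congruent d) = congruent (subst (+ m ∣_) (eq a b) (∣m⇒∣-m d))
    where
    eq : ∀ a b → ℤ.- (a ℤ.- b) ≡ ℤ.- a ℤ.- (ℤ.- b)
    eq = solve-∀

-- The inverse limit of the rings ℤ/pᵏ.  A residue class mod pᵏ is given by any
-- integer representing it, and _≈_ identifies different choices.
record ℤ-adic (p : ℕ) : Set where
  constructor mkAdic
  field
    residue  : ℕ → ℤ
    coherent : ∀ k → residue (suc k) ≡ residue k [mod p ^ k ]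

open ℤ-adic public

module Adic (p : ℕ) where

  infix  4 _≈_
  infixl 6 _+_
  infixl 7 _*_
  infix  8 -_

  record _≈_ (x y : ℤ-adic p) : Set where
    constructor mk≈
    field
      at : ∀ k → residue x k ≡ residue y k [mod p ^ k ]

  open _≈_ public

  ι : ℤ → ℤ-adic p
  ι a = mkAdic (λ _ → a) (λ _ → mod-reflexive refl)

  _+_ : ℤ-adic p → ℤ-adic p → ℤ-adic p
  x + y = mkAdic (λ k → residue x k ℤ.+ residue y k)
                 (λ k → mod-+ (coherent x k) (coherent y k))

  _*_ : ℤ-adic p → ℤ-adic p → ℤ-adic p
  x * y = mkAdic (λ k → residue x k ℤ.* residue y k)
                 (λ k → mod-* (coherent x k) (coherent y k))

  -_ : ℤ-adic p → ℤ-adic p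
  - x = mkAdic (λ k → ℤ.- residue x k) (λ k → mod-neg (coherent x k))

  private
    pointwise : ∀ {x y} → (∀ k → residue x k ≡ residue y k) → x ≈ y
    pointwise e = mk≈ λ k → mod-reflexive (e k)

  isCommutativeRing : IsCommutativeRing _≈_ _+_ _*_ -_ (ι 0ℤ) (ι 1ℤ)
  isCommutativeRing = record
    { isRing = record
      { +-isAbelianGroup = record
        { isGroup = record
          { isMonoid = record
            { isSemigroup = record
              { isMagma = record
                { isEquivalence = record
                  { refl  = pointwise λ _ → refl
                  ; sym   = λ e → mk≈ λ k → mod-sym (at e k)
                  ; trans = λ e f → mk≈ λ k → mod-trans (at e k) (at f k)
                  }
                ; ∙-cong = λ e f → mk≈ λ k → mod-+ (at e k) (at f k)
                }
              ; assoc = λ x y z →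
                  pointwise λ k → ℤ.+-assoc (residue x k) (residue y k) (residue z k)
              }
            ; identity = (λ x → pointwise λ k → ℤ.+-identityˡ (residue x k))
                       , (λ x → pointwise λ k → ℤ.+-identityʳ (residue x k))
            }
          ; inverse = (λ x → pointwise λ k → ℤ.+-inverseˡ (residue x k))
                    , (λ x → pointwise λ k → ℤ.+-inverseʳ (residue x k))
          ; ⁻¹-cong = λ e → mk≈ λ k → mod-neg (at e k)
          }
        ; comm = λ x y → pointwise λ k → ℤ.+-comm (residue x k) (residue y k)
        }
      ; *-cong = λ e f → mk≈ λ k → mod-* (at e k) (at f k)
      ; *-assoc = λ x y z →
          pointwise λ k → ℤ.*-assoc (residue x k) (residue y k) (residue z k)
      ; *-identity = (λ x → pointwise λ k → ℤ.*-identityˡ (residue x k))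
                   , (λ x → pointwise λ k → ℤ.*-identityʳ (residue x k))
      ; distrib =
          (λ x y z → pointwise λ k →
            ℤ.*-distribˡ-+ (residue x k) (residue y k) (residue z k))
        , (λ x y z → pointwise λ k →
            ℤ.*-distribʳ-+ (residue x k) (residue y k) (residue z k))
      }
    ; *-comm = λ x y → pointwise λ k → ℤ.*-comm (residue x k) (residue y k)
    }

  commutativeRing : CommutativeRing 0ℓ 0ℓ
  commutativeRing = record { isCommutativeRing = isCommutativeRing }

  evalₚ : ℤ[x] → ℤ-adic p → ℤ-adic p
  evalₚ = evalIn commutativeRing ι

  IsZeroOf : ℤ[x] → ℤ-adic p → Set
  IsZeroOf Q x = evalₚ Q x ≈ ι 0ℤ

HasAdicZero : ℕ → ℤ[x] → Set
HasAdicZero p Q = ∃[ x ] Adic.IsZeroOf p Q x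

{-# OPTIONS --safe #-}
module Submission where

-- The disjunction is decided effectively: either Q has a zero in ℤₚ, or some pᴺ
-- divides no Q(n).  Euclid's algorithm on Q and Q′ produces a polynomial shorter
-- than Q, and by induction on the length either it has a zero in ℤₚ, which is
-- then a common zero of Q and Q′, or Q and Q′ are never both divisible by a
-- certain pᴺ.  In the latter case Hensel's lemma lifts any zero of Q mod p²ᴺ, so a
-- finite search settles the matter.
-- If pᴺ divides no Q(n), then pᴺ is a period of V; the gcd of two periods is a
-- period, so the minimal one divides pᴺ.  A zero of Q makes V unbounded, hence not
-- periodic: a periodic V is finite everywhere, as a value ∞ would recur and give Q
-- infinitely many roots.

open import Defs
open import Data.Integer.Base as ℤ using (ℤ; +_; -[1+_]; +[1+_]; 0ℤ; 1ℤ; ∣_∣; _+_; _*_; _-_; -_)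
open import Data.Integer.Divisibility.Signed
open import Data.Integer.DivMod using (_%ℕ_; _/ℕ_; n%ℕd<d; a≡a%ℕn+[a/ℕn]*n)
import Data.Integer.Properties as ℤ
open import Data.Integer.Tactic.RingSolver using (solve-∀)
open import Data.List.Base using ([]; _∷_; length; map)
open import Data.List.Properties using (length-map)
open import Data.List.Relation.Unary.Any as Any using (Any; here; there)
open import Data.Nat.Base as ℕ using (ℕ; zero; suc; _^_; _≤_; _<_; s≤s; z≤n; _⊔_)
import Data.Nat.Coprimality as Coprimality
import Data.Nat.DivMod as ℕ
import Data.Nat.Divisibility as ℕ
import Data.Nat.GCD as ℕ
open import Data.Nat.Primality
  using (Prime; euclidsLemma; prime⇒nonZero; prime⇒nonTrivial; prime⇒irreducible)
import Data.Nat.Properties as ℕ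
open import Data.Product.Base as Product using (_×_; _,_; ∃-syntax; proj₁; proj₂)
open import Data.Sum.Base as Sum using (_⊎_; inj₁; inj₂; [_,_]′)
open import Function.Base using (_∘_)
open import Function.Bundles using (_⇔_; mk⇔; Equivalence)
open import Relation.Binary.Construct.Add.Supremum.NonStrict ℕ._≤_ as Sup using (_≤⁺_)
open import Relation.Binary.Definitions using (DecidableEquality)
open import Relation.Binary.PropositionalEquality
  using (_≡_; _≢_; refl; sym; trans; cong; cong₂; subst; module ≡-Reasoning)
open import Relation.Nullary using (¬_; Dec; yes; no; contradiction)
open import Relation.Nullary.Construct.Add.Supremum using (_⁺; [_]; ⊤⁺; ≡-dec)
open import Relation.Nullary.Decidable using (¬?)

-- Polynomials as functions on ℤ

eval-cong : ∀ Q {m a b} → a ≡ b [mod m ] → eval Q a ≡ eval Q b [mod m ]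
eval-cong []      a≡b = mod-reflexive refl
eval-cong (c ∷ q) a≡b = mod-+ (mod-reflexive {a = c} refl) (mod-* a≡b (eval-cong q a≡b))

mod-∣ : ∀ {m a b} → a ≡ b [mod m ] → + m ∣ a → + m ∣ b
mod-∣ {m} {a} {b} a≡b m∣a = subst (+ m ∣_) (eq a b) (∣m∣n⇒∣m+n (_≡_[mod_].divisible (mod-sym a≡b)) m∣a)
  where
  eq : ∀ a b → b - a + a ≡ b
  eq = solve-∀

mod-reduce : ∀ m .{{_ : ℕ.NonZero m}} z → z ≡ + (z %ℕ m) [mod m ]
mod-reduce m z = congruent (divides (z /ℕ m) (trans (cong (_- r) (a≡a%ℕn+[a/ℕn]*n z m)) (eq r _)))
  where
  r = + (z %ℕ m)
  eq : ∀ r y → r + y - r ≡ y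
  eq = solve-∀

eval-0 : ∀ a q → eval (a ∷ q) 0ℤ ≡ a
eval-0 a q = trans (cong (_+_ a) (ℤ.*-zeroˡ (eval q 0ℤ))) (ℤ.+-identityʳ a)

eval-allZero : ∀ q → ¬ NonZeroPoly q → ∀ x → eval q x ≡ 0ℤ
eval-allZero []      _  x = refl
eval-allZero (a ∷ q) q≡0 x with a ℤ.≟ 0ℤ
... | no  a≢0  = contradiction (here a≢0) q≡0
... | yes refl rewrite eval-allZero q (q≡0 ∘ there) x = trans (ℤ.+-identityˡ _) (ℤ.*-zeroʳ x)

nonZeroPoly? : ∀ q → Dec (NonZeroPoly q)
nonZeroPoly? = Any.any? (λ a → ¬? (a ℤ.≟ 0ℤ))

-- An integer root of a polynomial divides its constant term.
roots-bounded : ∀ Q → NonZeroPoly Q → ∃[ B ] (∀ m → eval Q (+ m) ≡ 0ℤ → m ≤ B)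
roots-bounded (a ∷ q) Q≢0 with a ℤ.≟ 0ℤ
-- Here Q = x q, whose roots are 0 and those of `q`; any bound for `q` covers 0 as well.
... | yes refl = let B , bound = roots-bounded q (Any.tail (λ 0≢0 → 0≢0 refl) Q≢0) in B , λ where
        zero      _ → z≤n
        m@(suc _) e → [ (λ ()) , bound m ]′
          (ℤ.i*j≡0⇒i≡0∨j≡0 (+ m) (trans (sym (ℤ.+-identityˡ _)) e))
... | no a≢0 = ∣ a ∣ , λ m e → ℕ.∣⇒≤ {{ℤ.≢-nonZero a≢0}} (∣⇒∣ᵤ (root∣a (+ m) e))
  where
  root∣a : ∀ m → eval (a ∷ q) m ≡ 0ℤ → m ∣ a
  root∣a m e = ∣m+n∣n⇒∣m (subst (m ∣_) (sym e) (divides 0ℤ refl)) (∣m⇒∣m*n _ ∣-refl)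

-- With `p` and `q` the tails of `a ∷ p` and `b ∷ q`, this is the combination of those two
-- polynomials in which the constant terms cancel, already divided by x.
crossDiff : ℤ → ℤ[x] → ℤ → ℤ[x] → ℤ[x]
crossDiff b []      a q       = map (λ y → - a * y) q
crossDiff b (x ∷ p) a []      = map (b *_) (x ∷ p)
crossDiff b (x ∷ p) a (y ∷ q) = b * x - a * y ∷ crossDiff b p a q

length-crossDiff : ∀ b p a q → length (crossDiff b p a q) ≡ length p ⊔ length q
length-crossDiff b []      a q       = length-map _ q
length-crossDiff b (x ∷ p) a []      = length-map _ (x ∷ p)
length-crossDiff b (x ∷ p) a (y ∷ q) = cong suc (length-crossDiff b p a q)

eval-scale : ∀ c q x → eval (map (c *_) q) x ≡ c * eval q x
eval-scale c []      x = sym (ℤ.*-zeroʳ c)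
eval-scale c (a ∷ q) x rewrite eval-scale c q x = eq c a x (eval q x)
  where
  eq : ∀ c a x y → c * a + x * (c * y) ≡ c * (a + x * y)
  eq = solve-∀

eval-crossDiff : ∀ b p a q x → eval (crossDiff b p a q) x ≡ b * eval p x - a * eval q x
eval-crossDiff b []      a q       x = trans (eval-scale (- a) q x) (eq a b (eval q x))
  where
  eq : ∀ a b y → - a * y ≡ b * 0ℤ - a * y
  eq = solve-∀
eval-crossDiff b (c ∷ p) a []      x = trans (eval-scale b (c ∷ p) x) (eq a b (eval (c ∷ p) x))
  where
  eq : ∀ a b y → b * y ≡ b * y - a * 0ℤ
  eq = solve-∀
eval-crossDiff b (c ∷ p) a (d ∷ q) x rewrite eval-crossDiff b p a q x =
  eq a b c d x (eval p x) (eval q x)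
  where
  eq : ∀ a b c d x y z → b * c - a * d + x * (b * y - a * z) ≡ b * (c + x * y) - a * (d + x * z)
  eq = solve-∀

-- The derivative and Taylor's formula

weigh : ℕ → ℤ[x] → ℤ[x]
weigh k []      = []
weigh k (a ∷ q) = + k * a ∷ weigh (suc k) q

-- `weigh k q` is k q + x q′, so `weigh 1 q` is the derivative of x q, and hence of a + x q.
∂ : ℤ[x] → ℤ[x]
∂ []      = []
∂ (a ∷ q) = weigh 1 q

length-weigh : ∀ k q → length (weigh k q) ≡ length q
length-weigh k []      = refl
length-weigh k (a ∷ q) = cong suc (length-weigh (suc k) q)

weigh-nonZero : ∀ k q → NonZeroPoly q → NonZeroPoly (weigh (suc k) q)
weigh-nonZero k (a ∷ q) (here a≢0)  =
  here λ e → [ (λ ()) , a≢0 ]′ (ℤ.i*j≡0⇒i≡0∨j≡0 (+ suc k) e)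
weigh-nonZero k (a ∷ q) (there q≢0) = there (weigh-nonZero (suc k) q q≢0)

eval-weigh-suc : ∀ k q x → eval (weigh (suc k) q) x ≡ eval q x + eval (weigh k q) x
eval-weigh-suc k []      x = refl
eval-weigh-suc k (a ∷ q) x rewrite eval-weigh-suc (suc k) q x =
  eq (+ k) a x (eval q x) (eval (weigh (suc k) q) x)
  where
  eq : ∀ k a x y z → (1ℤ + k) * a + x * (y + z) ≡ a + x * y + (k * a + x * z)
  eq = solve-∀

-- The product rule for x q, which is the form that the recursion in `taylor` consumes.
eval-∂ : ∀ a q x → eval (∂ (a ∷ q)) x ≡ eval q x + x * eval (∂ q) x
eval-∂ a q x = trans (eval-weigh-suc 0 q x) (cong (_+_ (eval q x)) (lemma q))
  where
  lemma : ∀ q → eval (weigh 0 q) x ≡ x * eval (∂ q) x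
  lemma []      = sym (ℤ.*-zeroʳ x)
  lemma (b ∷ q) = trans (cong (λ z → z + x * eval (weigh 1 q) x) (ℤ.*-zeroˡ b)) (ℤ.+-identityˡ _)

taylor : ∀ Q a h → ∃[ r ] eval Q (a + h) ≡ eval Q a + h * eval (∂ Q) a + h * h * r
taylor []      a h = 0ℤ , eq h
  where
  eq : ∀ h → 0ℤ ≡ 0ℤ + h * 0ℤ + h * h * 0ℤ
  eq = solve-∀
taylor (c ∷ q) a h with taylor q a h
-- With y and z the values of `q` and `∂ q` at `a`, what remains of (a + h)(y + h z + h² r) after a
-- y + h (y + a z) is h² times this witness.
... | r , e = eval (∂ q) a + (a + h) * r , lemma
  where
  eq : ∀ c a h y z r → c + (a + h) * (y + h * z + h * h * r)
                     ≡ c + a * y + h * (y + a * z) + h * h * (z + (a + h) * r)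
  eq = solve-∀
  lemma : eval (c ∷ q) (a + h)
        ≡ eval (c ∷ q) a + h * eval (∂ (c ∷ q)) a + h * h * (eval (∂ q) a + (a + h) * r)
  lemma rewrite e | eval-∂ c q a = eq c a h (eval q a) (eval (∂ q) a) r

-- Periods

module _ {A : Set} {s : ℕ → A} where

  shift-multiple : ∀ {T} → (∀ n → s (n ℕ.+ T) ≡ s n) → ∀ k n → s (n ℕ.+ k ℕ.* T) ≡ s n
  shift-multiple {T} per zero    n = cong s (ℕ.+-identityʳ n)
  shift-multiple {T} per (suc k) n = begin
    s (n ℕ.+ (T ℕ.+ k ℕ.* T)) ≡⟨ cong s (sym (ℕ.+-assoc n T _)) ⟩
    s (n ℕ.+ T ℕ.+ k ℕ.* T)   ≡⟨ shift-multiple per k (n ℕ.+ T) ⟩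
    s (n ℕ.+ T)               ≡⟨ per n ⟩
    s n                       ∎
    where open ≡-Reasoning

  period-reduce : ∀ {T} .{{_ : ℕ.NonZero T}} → (∀ n → s (n ℕ.+ T) ≡ s n) → ∀ n → s n ≡ s (n ℕ.% T)
  period-reduce {T} per n =
    trans (cong s (ℕ.m≡m%n+[m/n]*n n T)) (shift-multiple per (n ℕ./ T) (n ℕ.% T))

  -- Bézout over ℕ reads g + y T = x S, or the same with S and T exchanged: a shift by g followed by
  -- y shifts by T amounts to x shifts by S, and the multiples of S and T leave `s` unchanged.
  period-gcd : ∀ {S T} → IsPeriod s S → IsPeriod s T → IsPeriod s (ℕ.gcd S T)
  period-gcd {S} {T} (1≤S , perS) (_ , perT) = 1≤g , λ n → per (ℕ.Bézout.identity (ℕ.gcd-GCD S T)) n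
    where
    instance _ = ℕ.>-nonZero 1≤S
    g = ℕ.gcd S T
    1≤g : 1 ≤ g
    1≤g = ℕ.n≢0⇒n>0 (λ g≡0 → ℕ.≢-nonZero⁻¹ S (ℕ.gcd[m,n]≡0⇒m≡0 g≡0))
    combine : ∀ {S T} → (∀ n → s (n ℕ.+ S) ≡ s n) → (∀ n → s (n ℕ.+ T) ≡ s n) →
              ∀ x y → g ℕ.+ y ℕ.* T ≡ x ℕ.* S → ∀ n → s (n ℕ.+ g) ≡ s n
    combine {S} {T} perS perT x y e n = begin
      s (n ℕ.+ g)               ≡⟨ shift-multiple perT y (n ℕ.+ g) ⟨
      s (n ℕ.+ g ℕ.+ y ℕ.* T)   ≡⟨ cong s (ℕ.+-assoc n g _) ⟩
      s (n ℕ.+ (g ℕ.+ y ℕ.* T)) ≡⟨ cong (λ t → s (n ℕ.+ t)) e ⟩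
      s (n ℕ.+ x ℕ.* S)         ≡⟨ shift-multiple perS x n ⟩
      s n                       ∎
      where open ≡-Reasoning
    per : ℕ.Bézout.Identity g S T → ∀ n → s (n ℕ.+ g) ≡ s n
    per (ℕ.Bézout.+- x y e) = combine perS perT x y e
    per (ℕ.Bézout.-+ x y e) = combine perT perS y x e

  -- A sequence of known period M need only be compared on 0 … M − 1.
  isPeriod? : DecidableEquality A → ∀ {M} → IsPeriod s M → ∀ d → Dec (IsPeriod s d)
  isPeriod? _≟_ {M} (1≤M , perM) d with 1 ℕ.≤? d | ℕ.allUpTo? (λ n → s (n ℕ.+ d) ≟ s n) M
  ... | no ¬1≤d | _      = no (¬1≤d ∘ proj₁)
  ... | yes _   | no ¬per = no λ (_ , per) → ¬per (λ {n} _ → per n)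
  ... | yes 1≤d | yes per = yes (1≤d , per′)
    where
    instance _ = ℕ.>-nonZero 1≤M
    per′ : ∀ n → s (n ℕ.+ d) ≡ s n
    per′ n = begin
      s (n ℕ.+ d)                         ≡⟨ cong (λ t → s (t ℕ.+ d)) (ℕ.m≡m%n+[m/n]*n n M) ⟩
      s (r ℕ.+ q ℕ.* M ℕ.+ d)             ≡⟨ cong s (ℕ.+-assoc r _ d) ⟩
      s (r ℕ.+ (q ℕ.* M ℕ.+ d))           ≡⟨ cong (λ t → s (r ℕ.+ t)) (ℕ.+-comm _ d) ⟩
      s (r ℕ.+ (d ℕ.+ q ℕ.* M))           ≡⟨ cong s (ℕ.+-assoc r d _) ⟨
      s (r ℕ.+ d ℕ.+ q ℕ.* M)             ≡⟨ shift-multiple perM q (r ℕ.+ d) ⟩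
      s (r ℕ.+ d)                         ≡⟨ per (ℕ.m%n<n n M) ⟩
      s r                                 ≡⟨ period-reduce perM n ⟨
      s n                                 ∎
      where
      open ≡-Reasoning
      r = n ℕ.% M
      q = n ℕ./ M

finite⇒boundedBelow : (s : ℕ → ℕ ⁺) → (∀ n → ∃[ j ] s n ≡ [ j ]) →
                      ∀ T → ∃[ B ] (∀ n → n < T → s n ≤⁺ [ B ])
finite⇒boundedBelow s fin zero    = 0 , λ _ ()
finite⇒boundedBelow s fin (suc T) with finite⇒boundedBelow s fin T | fin T
... | B , bound | j , e = B ⊔ j , λ n n<1+T → case n (ℕ.m<1+n⇒m<n∨m≡n n<1+T)
  where
  case : ∀ n → n < T ⊎ n ≡ T → s n ≤⁺ [ B ⊔ j ]
  case n (inj₁ n<T)  = Sup.≤⁺-trans ℕ.≤-trans (bound n n<T) Sup.[ ℕ.m≤m⊔n B j ]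
  case n (inj₂ refl) = subst (_≤⁺ [ B ⊔ j ]) (sym e) Sup.[ ℕ.m≤n⊔m B j ]

-- Divisibility by powers of p

module _ {p : ℕ} (p-prime : Prime p) where

  private instance
    p-nonTrivial = prime⇒nonTrivial p-prime
    p-nonZero    = prime⇒nonZero p-prime

  p^_∣_ : ℕ → ℤ → Set
  p^ k ∣ z = + (p ^ k) ∣ z

  infix 4 p^_∣_

  p^j∣p^k : ∀ {j k} → j ≤ k → p ^ j ℕ.∣ p ^ k
  p^j∣p^k {j} {k} j≤k = subst (λ e → p ^ j ℕ.∣ p ^ e) (ℕ.m+[n∸m]≡n j≤k)
    (subst (p ^ j ℕ.∣_) (sym (ℕ.^-distribˡ-+-* p j (k ℕ.∸ j))) (ℕ.m∣m*n _))

  p^-mono : ∀ {j k z} → j ≤ k → p^ k ∣ z → p^ j ∣ z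
  p^-mono {j} {k} j≤k = ∣-trans (∣ᵤ⇒∣ (p^j∣p^k j≤k))

  mod-mono : ∀ {j k a b} → j ≤ k → a ≡ b [mod p ^ k ] → a ≡ b [mod p ^ j ]
  mod-mono j≤k (congruent d) = congruent (p^-mono j≤k d)

  -- Euclid's lemma finds a factor p in `m` or in `n`; cancelling it there lowers `i` or `j` by one,
  -- until one of them is 0.
  p^∣m*n⇒p^∣m⊎p^∣n : ∀ i j m n → p ^ (i ℕ.+ j) ℕ.∣ m ℕ.* n → p ^ i ℕ.∣ m ⊎ p ^ j ℕ.∣ n
  p^∣m*n⇒p^∣m⊎p^∣n zero    j       m n d = inj₁ (ℕ.1∣ m)
  p^∣m*n⇒p^∣m⊎p^∣n (suc i) zero    m n d = inj₂ (ℕ.1∣ n)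
  p^∣m*n⇒p^∣m⊎p^∣n (suc i) (suc j) m n d
    with euclidsLemma m n p-prime (ℕ.∣-trans (ℕ.m∣m*n _) d)
  ... | inj₁ (ℕ.divides m′ refl) =
    Sum.map₁ (subst (p ^ suc i ℕ.∣_) (ℕ.*-comm p m′) ∘ ℕ.*-monoʳ-∣ p)
      (p^∣m*n⇒p^∣m⊎p^∣n i (suc j) m′ n (ℕ.*-cancelˡ-∣ p (subst (p ^ (suc i ℕ.+ suc j) ℕ.∣_) eq d)))
    where
    eq : m′ ℕ.* p ℕ.* n ≡ p ℕ.* (m′ ℕ.* n)
    eq = trans (cong (ℕ._* n) (ℕ.*-comm m′ p)) (ℕ.*-assoc p m′ n)
  ... | inj₂ (ℕ.divides n′ refl) =
    Sum.map₂ (subst (p ^ suc j ℕ.∣_) (ℕ.*-comm p n′) ∘ ℕ.*-monoʳ-∣ p)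
      (p^∣m*n⇒p^∣m⊎p^∣n (suc i) j m n′ (ℕ.*-cancelˡ-∣ p
        (subst (ℕ._∣ p ℕ.* (m ℕ.* n′)) (cong (λ e → p ℕ.* p ^ e) (ℕ.+-suc i j))
          (subst (p ^ (suc i ℕ.+ suc j) ℕ.∣_) eq d))))
    where
    eq : m ℕ.* (n′ ℕ.* p) ≡ p ℕ.* (m ℕ.* n′)
    eq = trans (sym (ℕ.*-assoc m n′ p)) (ℕ.*-comm _ p)

  p^∣x*y⇒p^∣x⊎p^∣y : ∀ i j {x y} → p^ i ℕ.+ j ∣ x * y → p^ i ∣ x ⊎ p^ j ∣ y
  p^∣x*y⇒p^∣x⊎p^∣y i j {x} {y} d = Sum.map ∣ᵤ⇒∣ ∣ᵤ⇒∣
    (p^∣m*n⇒p^∣m⊎p^∣n i j ∣ x ∣ ∣ y ∣ (subst (p ^ (i ℕ.+ j) ℕ.∣_) (ℤ.abs-* x y) (∣⇒∣ᵤ d)))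

  divisor-of-p^ : ∀ k {d} → d ℕ.∣ p ^ k → IsPowerOf p d
  divisor-of-p^ zero    d∣1 = 0 , ℕ.∣1⇒≡1 d∣1
  divisor-of-p^ (suc k) {d} (ℕ.divides h e)
    with euclidsLemma h d p-prime (subst (p ℕ.∣_) e (ℕ.m∣m*n (p ^ k)))
  ... | inj₁ (ℕ.divides h′ refl) = divisor-of-p^ k (ℕ.divides h′ (ℕ.*-cancelˡ-≡ _ _ p
          (trans e (trans (cong (ℕ._* d) (ℕ.*-comm h′ p)) (ℕ.*-assoc p h′ d)))))
  ... | inj₂ (ℕ.divides d′ refl) =
    let j , d′≡ = divisor-of-p^ k (ℕ.divides h (ℕ.*-cancelˡ-≡ _ _ p
                    (trans e (trans (sym (ℕ.*-assoc h d′ p)) (ℕ.*-comm _ p)))))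
    in suc j , trans (ℕ.*-comm d′ p) (cong (p ℕ.*_) d′≡)

  -- The size of `c` serves as a crude bound on its valuation, since k < p^k. The exponents ∣ a ∣, ∣
  -- b ∣ and ∣ c ∣ below all come from here.
  p^∣c∣∤c : ∀ {c} → c ≢ 0ℤ → ¬ p^ ∣ c ∣ ∣ c
  p^∣c∣∤c {c} c≢0 d =
    ℕ.<⇒≱ (n<p^n p ∣ c ∣) (ℕ.∣⇒≤ {{ℤ.≢-nonZero c≢0}} (∣⇒∣ᵤ d))

  -- `t` is - w / u mod p. For u = n > 0, Bézout's coefficient y of n is - 1 / n or 1 / n mod p,
  -- whence the two signs.
  solve-linear : ∀ u → ¬ + p ∣ u → ∀ w → ∃[ t ] + p ∣ w + t * u
  solve-linear (+ n) p∤n w = go (Coprimality.coprime-Bézout coprime)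
    where
    coprime : Coprimality.Coprime p n
    coprime (d∣p , d∣n) with prime⇒irreducible p-prime d∣p
    ... | inj₁ d≡1  = d≡1
    ... | inj₂ refl = contradiction (∣ᵤ⇒∣ d∣n) p∤n
    cast : ∀ a b c d → 1 ℕ.+ a ℕ.* b ≡ c ℕ.* d → 1ℤ + + a * + b ≡ + c * + d
    cast a b c d e = trans (cong (_+_ 1ℤ) (sym (ℤ.pos-* a b))) (trans (cong +_ e) (ℤ.pos-* c d))
    go : ℕ.Bézout.Identity 1 p n → ∃[ t ] + p ∣ w + t * + n
    go (ℕ.Bézout.+- x y e) = w * + y , divides (w * + x)
      (trans (eq w (+ y) (+ n)) (trans (cong (w *_) (cast y n x p e)) (sym (ℤ.*-assoc w _ _))))
      where
      eq : ∀ w y n → w + w * y * n ≡ w * (1ℤ + y * n)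
      eq = solve-∀
    go (ℕ.Bézout.-+ x y e) = - (w * + y) , divides (- (w * + x))
      (trans (eq₁ w (+ y) (+ n)) (trans (cong (λ z → w - w * z) (sym (cast x p y n e))) (eq₂ w (+ x) (+ p))))
      where
      eq₁ : ∀ w y n → w + - (w * y) * n ≡ w - w * (y * n)
      eq₁ = solve-∀
      eq₂ : ∀ w x p → w - w * (1ℤ + x * p) ≡ - (w * x) * p
      eq₂ = solve-∀
  solve-linear u@(-[1+ n ]) p∤u w =
    let t , d = solve-linear (+ suc n) (λ p∣n → p∤u (∣m⇒∣-m p∣n)) w
    in - t , subst (+ p ∣_) (cong (_+_ w) (eq t (+ suc n))) d
    where
    eq : ∀ t n → t * n ≡ - t * - n
    eq = solve-∀

  -- Common zeros in ℤₚ

  -- Stated on integer representatives, so that divisibility in ℤ applies directly;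
  -- `isRoot⇔isZeroOf` identifies it with vanishing in the ring ℤₚ.
  IsRoot : ℤ[x] → ℤ-adic p → Set
  IsRoot P x = ∀ k → p^ k ∣ eval P (residue x k)

  residue-coherent : ∀ x j k → residue x (j ℕ.+ k) ≡ residue x k [mod p ^ k ]
  residue-coherent x zero    k = mod-reflexive refl
  residue-coherent x (suc j) k =
    mod-trans (mod-mono (ℕ.m≤n+m k j) (coherent x (j ℕ.+ k))) (residue-coherent x j k)

  -- Cancelling `c` costs fewer than ∣ c ∣ factors p, so the hypothesis is used at precision ∣ c ∣ +
  -- k, and coherence brings the residue back to precision k.
  root-cancel : ∀ {c} → c ≢ 0ℤ → ∀ P x → (∀ k → p^ k ∣ c * eval P (residue x k)) → IsRoot P x
  root-cancel {c} c≢0 P x cP k with p^∣x*y⇒p^∣x⊎p^∣y ∣ c ∣ k (cP (∣ c ∣ ℕ.+ k))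
  ... | inj₁ d = contradiction d (p^∣c∣∤c c≢0)
  ... | inj₂ d = mod-∣ (eval-cong P (residue-coherent x ∣ c ∣ k)) d

  root-zero : ∀ q → IsRoot (0ℤ ∷ q) (Adic.ι p 0ℤ)
  root-zero q k = subst (+ (p ^ k) ∣_) (sym (eval-0 0ℤ q)) (divides 0ℤ refl)

  -- As [] vanishes identically, Decided [] Q is the dichotomy for Q alone.
  Decided : ℤ[x] → ℤ[x] → Set
  Decided P₁ P₂ = (∃[ x ] IsRoot P₁ x × IsRoot P₂ x)
                ⊎ (∃[ N ] ∀ n → ¬ (p^ N ∣ eval P₁ n × p^ N ∣ eval P₂ n))

  decided-swap : ∀ P₁ P₂ → Decided P₁ P₂ → Decided P₂ P₁
  decided-swap _ _ = Sum.map (Product.map₂ Product.swap) (Product.map₂ (λ bound n → bound n ∘ Product.swap))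

  -- Where p^∣ b ∣ divides both x and b + x q, it would divide b. So when both polynomials are
  -- highly divisible, x absorbs fewer than ∣ b ∣ of the factors p, and the rest fall to `P`.
  decided-strip : ∀ {b} → b ≢ 0ℤ → ∀ P q → Decided P (b ∷ q) → Decided (0ℤ ∷ P) (b ∷ q)
  decided-strip {b} b≢0 P q (inj₁ (x , rP , rQ)) =
    inj₁ (x , (λ k → subst (+ (p ^ k) ∣_) (sym (ℤ.+-identityˡ _)) (∣n⇒∣m*n (residue x k) (rP k))) , rQ)
  decided-strip {b} b≢0 P q (inj₂ (N , bound)) = inj₂ (∣ b ∣ ℕ.+ N , bound′)
    where
    bound′ : ∀ n → ¬ (p^ ∣ b ∣ ℕ.+ N ∣ eval (0ℤ ∷ P) n × p^ ∣ b ∣ ℕ.+ N ∣ eval (b ∷ q) n)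
    bound′ n (d , e)
      with p^∣x*y⇒p^∣x⊎p^∣y ∣ b ∣ N {n} (subst (+ (p ^ (∣ b ∣ ℕ.+ N)) ∣_) (ℤ.+-identityˡ (n * eval P n)) d)
    ... | inj₁ ∣n = p^∣c∣∤c b≢0 (∣m+n∣n⇒∣m (p^-mono (ℕ.m≤m+n ∣ b ∣ N) e) (∣m⇒∣m*n {m = n} (eval q n) ∣n))
    ... | inj₂ ∣P = bound n (∣P , p^-mono (ℕ.m≤n+m N ∣ b ∣) e)

  -- With R the `crossDiff`, x R = b P₁ - a P₂. A common zero of x R and P₂ is therefore one of b
  -- P₁, and b cancels in ℤₚ; conversely, common divisibility of P₁ and P₂ passes to x R with no
  -- loss of exponent.
  decided-eliminate : ∀ {a b} → b ≢ 0ℤ → ∀ p₁ p₂ →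
                      Decided (crossDiff b p₁ a p₂) (b ∷ p₂) → Decided (a ∷ p₁) (b ∷ p₂)
  decided-eliminate {a} {b} b≢0 p₁ p₂ dec = transfer (decided-strip b≢0 (crossDiff b p₁ a p₂) p₂ dec)
    where
    x∙crossDiff : ∀ x → eval (0ℤ ∷ crossDiff b p₁ a p₂) x ≡ b * eval (a ∷ p₁) x - a * eval (b ∷ p₂) x
    x∙crossDiff x rewrite eval-crossDiff b p₁ a p₂ x = eq a b x (eval p₁ x) (eval p₂ x)
      where
      eq : ∀ a b x y z → 0ℤ + x * (b * y - a * z) ≡ b * (a + x * y) - a * (b + x * z)
      eq = solve-∀
    transfer : Decided (0ℤ ∷ crossDiff b p₁ a p₂) (b ∷ p₂) → Decided (a ∷ p₁) (b ∷ p₂)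
    transfer (inj₁ (x , rR , r₂)) = inj₁ (x , root-cancel b≢0 (a ∷ p₁) x r₁ , r₂)
      where
      r₁ : ∀ k → p^ k ∣ b * eval (a ∷ p₁) (residue x k)
      r₁ k = ∣m+n∣n⇒∣m (subst (+ (p ^ k) ∣_) (x∙crossDiff (residue x k)) (rR k)) (∣m⇒∣-m (∣n⇒∣m*n a (r₂ k)))
    transfer (inj₂ (N , bound)) = inj₂ (N , λ n (d , e) →
      bound n (subst (+ (p ^ N) ∣_) (sym (x∙crossDiff n)) (∣m∣n⇒∣m-n (∣n⇒∣m*n b d) (∣n⇒∣m*n a e)) , e))

  -- Euclid's algorithm, cancelling constant terms and then dividing by x, which
  -- vanishes at no common zero as long as one constant term is nonzero.
  decide-common : ∀ {n} → (∀ P → length P < n → Decided [] P) →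
                  ∀ k P₁ P₂ → length P₁ ℕ.+ length P₂ ≤ k → NonZeroPoly P₂ → length P₂ < n →
                  Decided P₁ P₂
  -- The algorithm has ended; what it leaves is shorter than `n`, so the outer induction decides it.
  decide-common single k       []       P₂       le P₂≢0 lt = single P₂ lt
  decide-common single (suc k) (a ∷ p₁) (b ∷ p₂) (s≤s le) P₂≢0 lt with a ℤ.≟ 0ℤ | b ℤ.≟ 0ℤ
  ... | yes refl | yes refl = inj₁ (Adic.ι p 0ℤ , root-zero p₁ , root-zero p₂)
  ... | yes refl | no b≢0   = decided-strip b≢0 p₁ p₂ (decide-common single k p₁ (b ∷ p₂) le P₂≢0 lt)
  ... | no a≢0   | yes refl = decided-swap (0ℤ ∷ p₂) (a ∷ p₁) (decided-strip a≢0 p₂ p₁ (decided-swap (a ∷ p₁) p₂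
          (decide-common single k (a ∷ p₁) p₂ (subst (_≤ k) (ℕ.+-suc _ _) le)
            (Any.tail (λ 0≢0 → 0≢0 refl) P₂≢0) (ℕ.<-trans (ℕ.n<1+n _) lt))))
  -- The longer polynomial is the one replaced, which lowers the total length by one. The other goes
  -- second: it is nonzero and still shorter than `n`.
  ... | no a≢0   | no b≢0 with ℕ.≤-total (length p₂) (length p₁)
  ...   | inj₁ p₂≤p₁ = decided-eliminate b≢0 p₁ p₂
            (decide-common single k (crossDiff b p₁ a p₂) (b ∷ p₂)
              (subst (λ l → l ℕ.+ suc (length p₂) ≤ k)
                (sym (trans (length-crossDiff b p₁ a p₂) (ℕ.m≥n⇒m⊔n≡m p₂≤p₁))) le)
              P₂≢0 lt)
  ...   | inj₂ p₁≤p₂ = decided-swap (b ∷ p₂) (a ∷ p₁) (decided-eliminate a≢0 p₂ p₁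
            (decide-common single k (crossDiff a p₂ b p₁) (a ∷ p₁)
              (subst (λ l → l ℕ.+ suc (length p₁) ≤ k)
                (sym (trans (length-crossDiff a p₂ b p₁) (ℕ.m≥n⇒m⊔n≡m p₁≤p₂)))
                (subst (_≤ k) (trans (ℕ.+-comm (length p₁) _) (sym (ℕ.+-suc (length p₂) _))) le))
              (here a≢0) (ℕ.≤-<-trans (s≤s p₁≤p₂) lt)))

  -- Hensel lifting

  exact-power : ∀ e m → ¬ p^ e ∣ m → ∃[ f ] ∃[ u ] f < e × m ≡ u * + (p ^ f) × ¬ + p ∣ u
  exact-power zero    m ∤m = contradiction (divides m (sym (ℤ.*-identityʳ m))) ∤m
  exact-power (suc e) m ∤m with + p ∣? m
  ... | no p∤m = 0 , m , s≤s z≤n , sym (ℤ.*-identityʳ m) , p∤m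
  ... | yes (divides m′ refl)
    with exact-power e m′ (λ d → ∤m (subst (_∣ m′ * + p) (trans (ℤ.*-comm _ (+ p)) (sym (ℤ.pos-* p (p ^ e))))
                                    (*-monoˡ-∣ (+ p) d)))
  ...   | f , u , f<e , refl , p∤u = suc f , u , s≤s f<e , eq , p∤u
    where
    eq : u * + (p ^ f) * + p ≡ u * + (p ^ suc f)
    eq = trans (ℤ.*-assoc u _ _) (cong (u *_) (trans (ℤ.*-comm _ (+ p)) (sym (ℤ.pos-* p (p ^ f)))))

  module Hensel (Q : ℤ[x]) {N : ℕ} (bound : ∀ n → ¬ (p^ N ∣ eval Q n × p^ N ∣ eval (∂ Q) n)) where

    -- A Newton step with a derivative that need not be a unit. Let Q(a) = w p^M and Q′(a) = u p^f,
    -- where f < N by `bound`, and move a by h = t p^(M-f). The terms up to first order give (w + t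
    -- u) p^M, and `t` is chosen to gain a factor p; the remainder is divisible by p^(2(M-f)), and
    -- 2(M-f) > M because f < N ≤ M - f.
    step : ∀ {a M} → N ℕ.+ N ≤ M → p^ M ∣ eval Q a →
           ∃[ b ] b ≡ a [mod p ^ (M ℕ.∸ N) ] × p^ suc M ∣ eval Q b
    step {a} {M} 2N≤M d@(divides w Qa)
      with exact-power N (eval (∂ Q) a) (λ e → bound a (p^-mono (ℕ.≤-trans (ℕ.m≤m+n N N) 2N≤M) d , e))
    ... | f , u , f<N , Q′a , p∤u with solve-linear u p∤u w
    ...   | t , p∣w+tu with taylor Q a (t * + (p ^ (M ℕ.∸ f)))
    ...     | r , Qb = a + h , congruent b≡a , subst (+ (p ^ suc M) ∣_) (sym eq) (∣m∣n⇒∣m+n first second)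
      where
      g = M ℕ.∸ f
      h = t * + (p ^ g)
      N≤g : N ≤ g
      N≤g = ℕ.m+n≤o⇒m≤o∸n N (ℕ.≤-trans (ℕ.+-monoʳ-≤ N (ℕ.<⇒≤ f<N)) 2N≤M)
      f+g≡M : f ℕ.+ g ≡ M
      f+g≡M = ℕ.m+[n∸m]≡n (ℕ.≤-trans (ℕ.<⇒≤ f<N) (ℕ.≤-trans (ℕ.m≤m+n N N) 2N≤M))
      pos-^ : ∀ i j → + (p ^ (i ℕ.+ j)) ≡ + (p ^ i) * + (p ^ j)
      pos-^ i j = trans (cong +_ (ℕ.^-distribˡ-+-* p i j)) (ℤ.pos-* (p ^ i) (p ^ j))
      b≡a : p^ M ℕ.∸ N ∣ a + h - a
      b≡a = subst (+ (p ^ (M ℕ.∸ N)) ∣_) (cancel a h)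
              (∣n⇒∣m*n t (∣ᵤ⇒∣ (p^j∣p^k (ℕ.∸-monoʳ-≤ M (ℕ.<⇒≤ f<N)))))
        where
        cancel : ∀ a h → h ≡ a + h - a
        cancel = solve-∀
      eq : eval Q (a + h) ≡ (w + t * u) * + (p ^ M) + + (p ^ (g ℕ.+ g)) * (t * t * r)
      eq = begin
        eval Q (a + h)
          ≡⟨ Qb ⟩
        eval Q a + h * eval (∂ Q) a + h * h * r
          ≡⟨ cong₂ (λ y z → y + h * z + h * h * r) Qa Q′a ⟩
        w * + (p ^ M) + h * (u * + (p ^ f)) + h * h * r
          ≡⟨ cong (λ m → w * m + h * (u * + (p ^ f)) + h * h * r) pM ⟩
        w * (+ (p ^ f) * + (p ^ g)) + h * (u * + (p ^ f)) + h * h * r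
          ≡⟨ expand w t u r (+ (p ^ f)) (+ (p ^ g)) ⟩
        (w + t * u) * (+ (p ^ f) * + (p ^ g)) + + (p ^ g) * + (p ^ g) * (t * t * r)
          ≡⟨ cong₂ (λ m n → (w + t * u) * m + n * (t * t * r)) pM (pos-^ g g) ⟨
        (w + t * u) * + (p ^ M) + + (p ^ (g ℕ.+ g)) * (t * t * r) ∎
        where
        open ≡-Reasoning
        pM : + (p ^ M) ≡ + (p ^ f) * + (p ^ g)
        pM = trans (cong (λ e → + (p ^ e)) (sym f+g≡M)) (pos-^ f g)
        expand : ∀ w t u r y z → w * (y * z) + t * z * (u * y) + t * z * (t * z) * r
                               ≡ (w + t * u) * (y * z) + z * z * (t * t * r)
        expand = solve-∀
      first : p^ suc M ∣ (w + t * u) * + (p ^ M)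
      first = subst (_∣ (w + t * u) * + (p ^ M)) (sym (ℤ.pos-* p (p ^ M))) (*-monoˡ-∣ (+ (p ^ M)) p∣w+tu)
      second : p^ suc M ∣ + (p ^ (g ℕ.+ g)) * (t * t * r)
      second = ∣m⇒∣m*n {m = + (p ^ (g ℕ.+ g))} (t * t * r) (∣ᵤ⇒∣ (p^j∣p^k
        (subst (λ e → suc e ≤ g ℕ.+ g) f+g≡M (ℕ.+-monoˡ-≤ g (ℕ.<-≤-trans f<N N≤g)))))

    module _ {a₀ : ℤ} (d₀ : p^ N ℕ.+ N ∣ eval Q a₀) where

      -- The surplus 2N keeps the hypothesis of `step` true at every stage. Stage `k` changes the
      -- approximation by a multiple of p^(k+N), which is enough for coherence mod p^k.
      approx : ∀ k → ∃[ a ] p^ k ℕ.+ (N ℕ.+ N) ∣ eval Q a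
      next : ∀ k → ∃[ b ] b ≡ proj₁ (approx k) [mod p ^ (k ℕ.+ (N ℕ.+ N) ℕ.∸ N) ]
                        × p^ suc (k ℕ.+ (N ℕ.+ N)) ∣ eval Q b

      approx zero    = a₀ , d₀
      approx (suc k) = Product.map₂ proj₂ (next k)

      next k = step (ℕ.m≤n+m (N ℕ.+ N) k) (proj₂ (approx k))

      limit : ℤ-adic p
      limit = mkAdic (proj₁ ∘ approx) λ k →
        mod-mono (ℕ.m+n≤o⇒m≤o∸n k (ℕ.+-monoʳ-≤ k (ℕ.m≤m+n N N))) (proj₁ (proj₂ (next k)))

      limit-root : IsRoot Q limit
      limit-root k = p^-mono (ℕ.m≤m+n k (N ℕ.+ N)) (proj₂ (approx k))

  -- The dichotomy for a single polynomial

  decide-separable : ∀ Q → Decided Q (∂ Q) → Decided [] Q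
  decide-separable Q (inj₁ (x , rQ , _)) = inj₁ (x , (λ k → divides 0ℤ refl) , rQ)
  decide-separable Q (inj₂ (N , bound)) = go (ℕ.anyUpTo? (λ n → + M ∣? eval Q (+ n)) M)
    where
    M = p ^ (N ℕ.+ N)
    instance _ = ℕ.m^n≢0 p (N ℕ.+ N)
    module H = Hensel Q {N} bound
    -- Divisibility of Q(z) by M depends only on z mod M, so the search below M is exhaustive; a hit
    -- is a starting point for the lifting.
    go : Dec (∃[ n ] n < M × + M ∣ eval Q (+ n)) → Decided [] Q
    go (yes (n , _ , d)) = inj₁ (H.limit d , (λ k → divides 0ℤ refl) , H.limit-root d)
    go (no none)         = inj₂ (N ℕ.+ N , λ z (_ , d) →
      none (z %ℕ M , n%ℕd<d z M , mod-∣ (eval-cong Q (mod-reduce M z)) d))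

  decide-length< : ∀ n Q → length Q < n → Decided [] Q
  decide-length< (suc n) []      _        = inj₁ (Adic.ι p 0ℤ , (λ k → divides 0ℤ refl) , λ k → divides 0ℤ refl)
  decide-length< (suc n) (a ∷ q) (s≤s lt) with a ℤ.≟ 0ℤ | nonZeroPoly? q
  ... | yes refl | _      = inj₁ (Adic.ι p 0ℤ , (λ k → divides 0ℤ refl) , root-zero q)
  ... | no a≢0   | no q≡0 = inj₂ (∣ a ∣ , λ z (_ , d) → p^∣c∣∤c a≢0 (subst (+ (p ^ ∣ a ∣) ∣_) (const z) d))
    where
    const : ∀ z → eval (a ∷ q) z ≡ a
    const z rewrite eval-allZero q q≡0 z = trans (cong (_+_ a) (ℤ.*-zeroʳ z)) (ℤ.+-identityʳ a)
  -- The derivative is nonzero in characteristic 0 and has one coefficient fewer than Q, so it can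
  -- be the second polynomial, whose length the induction controls.
  ... | no a≢0   | yes q≢0 = decide-separable (a ∷ q)
    (decide-common (decide-length< n) _ (a ∷ q) (weigh 1 q) ℕ.≤-refl
      (weigh-nonZero 0 q q≢0) (subst (_< n) (sym (length-weigh 1 q)) lt))

  decide : ∀ Q → (∃[ x ] IsRoot Q x) ⊎ (∃[ N ] ∀ n → ¬ p^ N ∣ eval Q n)
  decide Q = Sum.map (Product.map₂ proj₂) (Product.map₂ λ bound n d → bound n (divides 0ℤ refl , d))
               (decide-length< (suc (length Q)) Q (ℕ.n<1+n _))

  residue-evalₚ : ∀ Q x k → residue (Adic.evalₚ p Q x) k ≡ eval Q (residue x k)
  residue-evalₚ []      x k = refl
  residue-evalₚ (a ∷ q) x k = cong (λ y → a + residue x k * y) (residue-evalₚ q x k)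

  isRoot⇔isZeroOf : ∀ Q x → IsRoot Q x ⇔ Adic.IsZeroOf p Q x
  isRoot⇔isZeroOf Q x = mk⇔
    (λ r → Adic.mk≈ λ k → congruent (subst (+ (p ^ k) ∣_) (sym (eq k)) (r k)))
    (λ e k → subst (+ (p ^ k) ∣_) (eq k) (_≡_[mod_].divisible (Adic.at e k)))
    where
    eq : ∀ k → residue (Adic.evalₚ p Q x) k - 0ℤ ≡ eval Q (residue x k)
    eq k = trans (ℤ.+-identityʳ _) (residue-evalₚ Q x k)

  -- Valuations

  ν-finite : ∀ {z} → z ≢ 0ℤ → ∃[ j ] ν p z ≡ [ j ]
  ν-finite {+ zero}   z≢0 = contradiction refl z≢0
  ν-finite {+[1+ n ]} _   = _ , refl
  ν-finite { -[1+ n ]} _  = _ , refl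

  p^∤⇒≢0 : ∀ k {z} → ¬ p^ k ∣ z → z ≢ 0ℤ
  p^∤⇒≢0 k ∤z refl = ∤z (divides 0ℤ refl)

  -- Since p^N does not divide `y`, i < N, so the congruence mod p^N is fine enough to carry p^i
  -- from `y` to `z`.
  ν-mono : ∀ N {y z i j} → ¬ p^ N ∣ y → y ≡ z [mod p ^ N ] → ν p y ≡ [ i ] → ν p z ≡ [ j ] → i ≤ j
  ν-mono N {y} {z} {i} {j} ∤y y≡z νy νz =
    ν-greatest p z j νz i (∣⇒∣ᵤ (mod-∣ (mod-mono {i} {N} (ℕ.<⇒≤ i<N) y≡z) p^i∣y))
    where
    p^i∣y : p^ i ∣ y
    p^i∣y = ∣ᵤ⇒∣ (ν-∣ p y i νy)
    i<N : i < N
    i<N = ℕ.≰⇒> (λ N≤i → ∤y (p^-mono N≤i p^i∣y))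

  ν-cong : ∀ N {y z} → ¬ p^ N ∣ y → y ≡ z [mod p ^ N ] → ν p y ≡ ν p z
  ν-cong N {y} {z} ∤y y≡z =
    let i , νy = ν-finite (p^∤⇒≢0 N ∤y)
        j , νz = ν-finite (p^∤⇒≢0 N ∤z)
    in trans νy (trans (cong [_] (ℕ.≤-antisym (ν-mono N ∤y y≡z νy νz) (ν-mono N ∤z (mod-sym y≡z) νz νy))) (sym νz))
    where
    ∤z : ¬ p^ N ∣ z
    ∤z d = ∤y (mod-∣ (mod-sym y≡z) d)

  bounded⇒periodic : ∀ Q N → (∀ n → ¬ p^ N ∣ eval Q n) → IsPeriod (V p Q) (p ^ N)
  bounded⇒periodic Q N bound = ℕ.m^n>0 p N , λ n →
    ν-cong N (bound _) (eval-cong Q (congruent (divides 1ℤ (eq (+ n) (+ (p ^ N))))))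
    where
    eq : ∀ n m → n + m - n ≡ 1ℤ * m
    eq = solve-∀

  root⇒unbounded : ∀ Q x → IsRoot Q x → Unbounded (V p Q)
  root⇒unbounded Q x r B bound = go (ν p (eval Q (+ n))) refl (bound n)
    where
    instance _ = ℕ.m^n≢0 p (suc B)
    n = residue x (suc B) %ℕ p ^ suc B
    go : ∀ v → ν p (eval Q (+ n)) ≡ v → ¬ v ≤⁺ [ B ]
    -- The value ∞ is not below `[ B ]`. A finite one is at least B + 1, because `n` represents x
    -- mod p^(B+1).
    go [ j ] e Sup.[ j≤B ] = ℕ.<⇒≱ (ν-greatest p (eval Q (+ n)) j e (suc B)
      (∣⇒∣ᵤ (mod-∣ (eval-cong Q (mod-reduce (p ^ suc B) (residue x (suc B)))) (r (suc B))))) j≤B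

  periodic⇒finite : ∀ {Q} → NonZeroPoly Q → Periodic (V p Q) → ∀ n → ∃[ j ] V p Q n ≡ [ j ]
  periodic⇒finite {Q} Q≢0 (T , 1≤T , per) n = ν-finite λ Qn≡0 →
    let B , bound = roots-bounded Q Q≢0
        -- As T ≥ 1, B + 1 periods carry the root `n` past every possible root.
        m = n ℕ.+ suc B ℕ.* T
        B<m : B < m
        B<m = ℕ.≤-trans (ℕ.m≤m*n (suc B) T {{ℕ.>-nonZero 1≤T}}) (ℕ.m≤n+m _ n)
    in ℕ.<⇒≱ B<m (bound m (ν-⊤ (trans (shift-multiple {s = V p Q} per (suc B) n) (cong (ν p) Qn≡0))))
    where
    ν-⊤ : ∀ {z} → ν p z ≡ ⊤⁺ → z ≡ 0ℤ
    ν-⊤ {+ zero} _ = refl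

  periodic⇒¬unbounded : ∀ {Q} → NonZeroPoly Q → Periodic (V p Q) → ¬ Unbounded (V p Q)
  periodic⇒¬unbounded {Q} Q≢0 P@(T , 1≤T , per) unb =
    let B , bound = finite⇒boundedBelow (V p Q) (periodic⇒finite Q≢0 P) T
    in unb B λ n → subst (_≤⁺ [ B ]) (sym (period-reduce {s = V p Q} per n)) (bound (n ℕ.% T) (ℕ.m%n<n n T))
    where instance _ = ℕ.>-nonZero 1≤T

  -- The minimal period

  minimal-period : ∀ {s : ℕ → ℕ ⁺} N → IsPeriod s (p ^ N) → ∃[ T ] (IsMinimalPeriod s T × IsPowerOf p T)
  minimal-period     zero    P = 1 , (P , λ _ → proj₁) , 0 , refl
  -- Factors p are removed for as long as the quotient is still a period.
  minimal-period {s} (suc N) P with isPeriod? {s = s} (≡-dec ℕ._≟_) P (p ^ N)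
  ... | yes P′ = minimal-period N P′
  ... | no ¬P′ = p ^ suc N , (P , minimal) , suc N , refl
    where
    minimal : ∀ T → IsPeriod s T → p ^ suc N ≤ T
    minimal T PT with divisor-of-p^ (suc N) (ℕ.gcd[m,n]∣n T (p ^ suc N))
    -- The gcd p^j of `T` and p^(N+1) is itself a period. If j ≤ N, its multiple p^N would be one
    -- too; otherwise p^(N+1) ≤ p^j ≤ T.
    ... | j , g≡p^j with j ℕ.≤? N
    ...   | yes j≤N = contradiction period-p^N ¬P′
      where
      period-p^N : IsPeriod s (p ^ N)
      period-p^N with p^j∣p^k j≤N
      ... | ℕ.divides q e = ℕ.m^n>0 p N , λ n → trans (cong (λ t → s (n ℕ.+ t)) e)
              (shift-multiple {s = s} (proj₂ (subst (IsPeriod s) g≡p^j (period-gcd {s = s} PT P))) q n)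
    ...   | no j≰N = begin
      p ^ suc N           ≤⟨ ℕ.^-monoʳ-≤ p (ℕ.≰⇒> j≰N) ⟩
      p ^ j               ≡⟨ g≡p^j ⟨
      ℕ.gcd T (p ^ suc N) ≤⟨ ℕ.∣⇒≤ {{ℕ.>-nonZero (proj₁ PT)}} (ℕ.gcd[m,n]∣m T _) ⟩
      T                   ∎
      where open ℕ.≤-Reasoning

theorem2p1 : ∀ (p : ℕ) → Prime p → ∀ (Q : ℤ[x]) → NonZeroPoly Q →
    (Periodic (V p Q) ⊎ Unbounded (V p Q))
    × (Periodic (V p Q) ⇔ (¬ HasAdicZero p Q))
    × (Periodic (V p Q) → ∃[ T ] (IsMinimalPeriod (V p Q) T × IsPowerOf p T))
theorem2p1 p p-prime Q Q≢0 with decide p-prime Q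
... | inj₁ (x , r) = inj₂ unbounded
                   , mk⇔ (λ P → contradiction P ¬periodic)
                         (λ ¬zero → contradiction (x , Equivalence.to (isRoot⇔isZeroOf p-prime Q x) r) ¬zero)
                   , λ P → contradiction P ¬periodic
  where
  unbounded = root⇒unbounded p-prime Q x r
  ¬periodic : ¬ Periodic (V p Q)
  ¬periodic P = periodic⇒¬unbounded p-prime Q≢0 P unbounded
... | inj₂ (N , bound) = inj₁ periodic
                       -- At a zero x, p^N would divide Q at the integer `residue x N`; `bound`
                       -- covers all integers, not only the naturals.
                       , mk⇔ (λ _ (x , e) → bound (residue x N) (Equivalence.from (isRoot⇔isZeroOf p-prime Q x) e N))
                             (λ _ → periodic)
                       , λ _ → minimal-period p-prime N (proj₂ periodic)
  where
  periodic : Periodic (V p Q)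
  periodic = p ^ N , bounded⇒periodic p-prime Q N bound
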